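{- For all $t,t',u'\in\mathbb{T}^\infty$: if $t\succ t'$ and $t'\to^\infty u'$ then there is $u$ with $t\to^\infty u$ and $u\succ u'$.
   Context: $\mathbb{T}^\infty$ is the set of finite and infinite terms (modulo $\alpha$-conversion) generated by $t ::= x \mid c \mid \lambda x.t \mid t\,t \mid \mathrm{case}(t;\{c_k\vec{x}_k \Rightarrow t_k \mid k=1,\dots,n\})$ ($x$ variables, $c,c_k$ constructors). $\to_{\beta\iota}$ is the closure under term contexts of $(\lambda x.t)t' \to t[t'/x]$ and $\mathrm{case}(c_k\vec u;\{c_l\vec x_l\Rightarrow t_l\}) \to t_k[\vec u/\vec x_k]$ ($\vec u,\vec x_k$ same length, variables in each $\vec x_l$ distinct, $c_l$ distinct); $\to^*$ its reflexive–transitive closure. $\to^\infty$ is the largest relation such that $t\to^\infty t'$ implies one of: $t'$ a variable or constructor with $t\to^*t'$; $t'=\lambda x.r'$, $t\to^*\lambda x.r$, $r\to^\infty r'$; $t'=r_1'r_2'$, $t\to^*r_1r_2$, $r_i\to^\infty r_i'$; $t'=\mathrm{case}(r';\{c_k\vec x_k\Rightarrow r_k'\})$, $t\to^*\mathrm{case}(r;\{c_k\vec x_k\Rightarrow r_k\})$, $r\to^\infty r'$, $r_k\to^\infty r_k'$. Let $\bot=(\lambda x.xx)(\lambda x.xx)$. The relation $\succ$ is the largest relation such that $t\succ t'$ implies: $t'=\bot$; or $t=t'$ is a variable or a constructor; or $t=\lambda x.p$, $t'=\lambda x.p'$ and $p\succ p'$; or $t=p_1p_2$, $t'=p_1'p_2'$,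 $p_1\succ p_1'$ and $p_2\succ p_2'$; or $t=\mathrm{case}(p;\{c_k\vec x\Rightarrow p_k\})$, $t'=\mathrm{case}(p';\{c_k\vec x\Rightarrow p_k'\})$, $p\succ p'$ and $p_k\succ p_k'$ for all $k$ (i.e. $t'$ is $t$ with some subterms replaced by $\bot$). -}

module Defs where

-- Since coinductive records are unavailable (--guardedness is not allowed),
-- a finite-or-infinite term is represented as a labelled tree given by a
-- function from positions (paths of child indices, read from the root) to
-- node labels.  Variables are (unscoped) de Bruijn indices, so terms are
-- taken modulo α-conversion (and may have infinitely many free variables).  Labels at positions that are not
-- valid positions of the tree are junk; every notion below only inspects
-- valid positions, and equality of terms is agreement on valid positions.

open import Data.Nat using (ℕ; zero; suc; _<_)
open import Data.Fin using (Fin; toℕ)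
open import Data.List using (List; []; _∷_; length; lookup; map)
open import Data.List.Relation.Unary.Unique.Propositional using (Unique)
open import Data.Product using (Σ; _×_; _,_; proj₁; proj₂)
open import Data.Sum using (_⊎_)
open import Data.Unit using (⊤)
open import Relation.Binary.PropositionalEquality using (_≡_; _≢_)
open import Relation.Binary.Construct.Closure.ReflexiveTransitive using (Star)

Con : Set
Con = ℕ

-- case sig : a case node whose branches are  c_k x₁ … x_{m_k} ⇒ t_k  with
-- sig = (c₁ , m₁) ∷ … ∷ (cₙ , mₙ) ∷ [].  Child 0 is the scrutinee, child
-- 1+k is the body of branch k (0-based).  In that body the index 0 refers
-- to x_{m_k}, the index m_k - 1 to x₁, and m_k + j to the outer variable j.
data Label : Set where
  var  : ℕ → Label
  con  : Con → Label
  lam  : Label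
  app  : Label
  case : List (Con × ℕ) → Label

arity : Label → ℕ
arity (var _)    = 0
arity (con _)    = 0
arity lam        = 1
arity app        = 2
arity (case sig) = suc (length sig)

nth-arity : List (Con × ℕ) → ℕ → ℕ
nth-arity []             _       = 0
nth-arity ((_ , m) ∷ _)  zero    = m
nth-arity (_ ∷ sig)      (suc k) = nth-arity sig k

binds : Label → ℕ → ℕ
binds lam        zero    = 1
binds (case sig) (suc k) = nth-arity sig k
binds _          _       = 0

Pos : Set
Pos = List ℕ

Tm : Set
Tm = Pos → Label

root : Tm → Label
root t = t []

child : Tm → ℕ → Tm
child t i p = t (i ∷ p)

Valid : Tm → Pos → Set
Valid t []      = ⊤
Valid t (i ∷ p) = (i < arity (root t)) × Valid (child t i) p

infix 4 _≈_
_≈_ : Tm → Tm → Set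
t ≈ t' = ∀ p → Valid t p → t p ≡ t' p

‵var : ℕ → Tm
‵var x _ = var x

liftR : (ℕ → ℕ) → ℕ → ℕ
liftR ρ zero    = zero
liftR ρ (suc i) = suc (ρ i)

liftRN : ℕ → (ℕ → ℕ) → ℕ → ℕ
liftRN zero    ρ = ρ
liftRN (suc m) ρ = liftR (liftRN m ρ)

renLab : (ℕ → ℕ) → Label → Label
renLab ρ (var x) = var (ρ x)
renLab ρ l       = l

ren : (ℕ → ℕ) → Tm → Tm
ren ρ t []      = renLab ρ (root t)
ren ρ t (i ∷ p) = ren (liftRN (binds (root t) i) ρ) (child t i) p

exts : (ℕ → Tm) → ℕ → Tm
exts σ zero    = ‵var zero
exts σ (suc i) = ren suc (σ i)

extsN : ℕ → (ℕ → Tm) → ℕ → Tm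
extsN zero    σ = σ
extsN (suc m) σ = exts (extsN m σ)

sub : (ℕ → Tm) → Tm → Tm
sub σ t p with root t
sub σ t p       | var x = σ x p
sub σ t []      | l     = l
sub σ t (i ∷ p) | l     = sub (extsN (binds l i) σ) (child t i) p

-- consSub (uₘ ∷ … ∷ u₁ ∷ []) maps index i < m to u_{m-i} and m + j to j
consSub : List Tm → ℕ → Tm
consSub []       i       = ‵var i
consSub (u ∷ us) zero    = u
consSub (u ∷ us) (suc i) = consSub us i

-- ⊥ = (λx.xx)(λx.xx)

‵ωbody : Tm
‵ωbody []      = app
‵ωbody (_ ∷ _) = var zero

‵ω : Tm
‵ω []      = lam
‵ω (_ ∷ p) = ‵ωbody p

‵⊥ : Tm
‵⊥ []      = app
‵⊥ (_ ∷ p) = ‵ω p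

-- Spines:  Spine s c (uₘ ∷ … ∷ u₁ ∷ [])  iff  s = c u₁ … uₘ

data Spine : Tm → Con → List Tm → Set where
  head : ∀ {s c} → root s ≡ con c → Spine s c []
  arg  : ∀ {s c us} → root s ≡ app → Spine (child s 0) c us →
         Spine s c (child s 1 ∷ us)

infix 4 _⟶_
data _⟶_ : Tm → Tm → Set where
  β   : ∀ {t t'} → root t ≡ app → root (child t 0) ≡ lam →
        t' ≈ sub (consSub (child t 1 ∷ [])) (child (child t 0) 0) →
        t ⟶ t'
  ι   : ∀ {t t' sig c m us} → root t ≡ case sig →
        Unique (map proj₁ sig) →
        (k : Fin (length sig)) → lookup sig k ≡ (c , m) →
        Spine (child t 0) c us → length us ≡ m →
        t' ≈ sub (consSub us) (child t (suc (toℕ k))) →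
        t ⟶ t'
  ctx : ∀ {t t'} (i : ℕ) → root t ≡ root t' → i < arity (root t) →
        child t i ⟶ child t' i →
        (∀ j → j < arity (root t) → j ≢ i → child t j ≈ child t' j) →
        t ⟶ t'

infix 4 _⟶*_
_⟶*_ : Tm → Tm → Set
t ⟶* t' = Σ Tm (λ s → Star _⟶_ t s × s ≈ t')

Rel : Set₁
Rel = Tm → Tm → Set

_⊆_ : Rel → Rel → Set
R ⊆ S = ∀ t t' → R t t' → S t t'

InfStep : Rel → Rel
InfStep R t t' =
  Σ Tm (λ s → (t ⟶* s) × (root s ≡ root t') ×
    (∀ i → i < arity (root t') → R (child s i) (child t' i)))

infix 4 _⟶∞_
_⟶∞_ : Tm → Tm → Set₁
t ⟶∞ t' = Σ Rel (λ R → (R ⊆ InfStep R) × R t t')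

PreStep : Rel → Rel
PreStep R t t' =
  (t' ≈ ‵⊥) ⊎
  ((root t ≡ root t') ×
    (∀ i → i < arity (root t) → R (child t i) (child t' i)))

infix 4 _≻_
_≻_ : Tm → Tm → Set₁
t ≻ t' = Σ Rel (λ R → (R ⊆ PreStep R) × R t t')

-- Read ≻ position by position: t ≻ t' says that at every finite position either
-- t' has a ⊥ above it or t and t' carry the same label.  One step t' ⟶ s' is then
-- matched by at most one step of t: a step inside a ⊥ of t' is absorbed, since ⊥
-- only reduces to ⊥, and any other redex of t' is a redex of t whose contractum
-- stays ≻-above, because ≻ is closed under substitution.  Hence finite reductions
-- lift.  The term u is then built layer by layer along the infinitary reduction
-- t' ⟶∞ u': where the reduction of t' reaches a ⊥, u' is ⊥ there too, since ⊥
-- only reduces to itself, and u keeps the current subterm of t; elsewhere u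
-- follows the lifted reduction of t and the construction continues in the children.

module Submission where

open import Defs
open import Data.Nat using (ℕ; zero; suc; _<_; _≟_; _<?_; z<s; s<s)
open import Data.Fin using (Fin; toℕ)
open import Data.Fin.Properties using (toℕ<n)
open import Data.List using (List; []; _∷_; length; lookup; map)
open import Data.List.Relation.Unary.Unique.Propositional using (Unique)
open import Data.List.Relation.Binary.Pointwise using (Pointwise; []; _∷_; Pointwise-length)
open import Data.Product using (Σ; _×_; _,_; proj₁; proj₂)
open import Data.Sum using (_⊎_; inj₁; inj₂)
open import Data.Unit using (⊤; tt)
open import Data.Empty using (⊥; ⊥-elim)
open import Relation.Nullary using (¬_; Dec; yes; no)
open import Relation.Nullary.Decidable using (_×-dec_)
open import Relation.Binary.PropositionalEquality using (_≡_; _≢_; _≗_; refl; sym; trans; cong; subst)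
open import Relation.Binary.Construct.Closure.ReflexiveTransitive using (Star; ε; _◅_; _◅◅_; gmap)

infix 4 _≐_ _≐ˢ_ _≻ᵖ_ _≻ˢ_

-- Agreement at every position, junk included: stronger than ≈, but respected by
-- ren and sub without any bookkeeping of valid positions.
_≐_ : Tm → Tm → Set
a ≐ b = ∀ p → a p ≡ b p

≐-sym : ∀ {a b} → a ≐ b → b ≐ a
≐-sym e p = sym (e p)

≐⇒≈ : ∀ {a b} → a ≐ b → a ≈ b
≐⇒≈ e p _ = e p

child-≐ : ∀ {a b} i → a ≐ b → child a i ≐ child b i
child-≐ i e q = e (i ∷ q)

<-arity : ∀ {l l′ i} → l ≡ l′ → i < arity l → i < arity l′
<-arity {i = i} = subst (λ l → i < arity l)

≈-refl : ∀ {a} → a ≈ a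
≈-refl p _ = refl

child-≈ : ∀ {a b i} → a ≈ b → i < arity (root a) → child a i ≈ child b i
child-≈ {i = i} e lt q vq = e (i ∷ q) (lt , vq)

≈-Valid : ∀ {a b} p → a ≈ b → Valid a p → Valid b p
≈-Valid [] e v = tt
≈-Valid {a} {b} (i ∷ p) e (lt , v) =
  <-arity (e [] tt) lt , ≈-Valid p (child-≈ {a} {b} e lt) v

≈-Valid⁻ : ∀ {a b} p → a ≈ b → Valid b p → Valid a p
≈-Valid⁻ [] e v = tt
≈-Valid⁻ {a} {b} (i ∷ p) e (lt , v) =
  lt′ , ≈-Valid⁻ p (child-≈ {a} {b} e lt′) v
  where
  lt′ : i < arity (root a)
  lt′ = <-arity (sym (e [] tt)) lt

≈-sym : ∀ {a b} → a ≈ b → b ≈ a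
≈-sym e p v = sym (e p (≈-Valid⁻ p e v))

≈-trans : ∀ {a b c} → a ≈ b → b ≈ c → a ≈ c
≈-trans e₁ e₂ p v = trans (e₁ p v) (e₂ p (≈-Valid p e₁ v))

-- Unlike a ≈ ‵⊥, these predicates inspect finitely many positions, so they are
-- decidable and their stability under reduction and substitution is a computation.

IsωBody : Tm → Set
IsωBody a = (root a ≡ app) × (a (0 ∷ []) ≡ var 0) × (a (1 ∷ []) ≡ var 0)

Isω : Tm → Set
Isω a = (root a ≡ lam) × IsωBody (child a 0)

Is⊥ : Tm → Set
Is⊥ a = (root a ≡ app) × Isω (child a 0) × Isω (child a 1)

app? : (l : Label) → Dec (l ≡ app)
app? app      = yes refl
app? (var _)  = no λ ()
app? (con _)  = no λ ()
app? lam      = no λ ()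
app? (case _) = no λ ()

lam? : (l : Label) → Dec (l ≡ lam)
lam? lam      = yes refl
lam? (var _)  = no λ ()
lam? (con _)  = no λ ()
lam? app      = no λ ()
lam? (case _) = no λ ()

var0? : (l : Label) → Dec (l ≡ var 0)
var0? (var zero)    = yes refl
var0? (var (suc _)) = no λ ()
var0? (con _)       = no λ ()
var0? lam           = no λ ()
var0? app           = no λ ()
var0? (case _)      = no λ ()

isωBody? : ∀ a → Dec (IsωBody a)
isωBody? a = app? (root a) ×-dec var0? (a (0 ∷ [])) ×-dec var0? (a (1 ∷ []))

isω? : ∀ a → Dec (Isω a)
isω? a = lam? (root a) ×-dec isωBody? (child a 0)

is⊥? : ∀ a → Dec (Is⊥ a)
is⊥? a = app? (root a) ×-dec isω? (child a 0) ×-dec isω? (child a 1)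

lam-¬⊥ : ∀ {a} → root a ≡ lam → ¬ Is⊥ a
lam-¬⊥ e (e′ , _) with trans (sym e) e′
... | ()

IsωBody-sound : ∀ {a} → IsωBody a → a ≈ ‵ωbody
IsωBody-sound (e , _ , _) [] _ = e
IsωBody-sound (_ , e₀ , _) (0 ∷ []) _ = e₀
IsωBody-sound (_ , _ , e₁) (1 ∷ []) _ = e₁
IsωBody-sound {a} (e , _ , _) (suc (suc _) ∷ _) (lt , _) with root a | e
... | .app | refl with lt
... | s<s (s<s ())
IsωBody-sound {a} (_ , e₀ , _) (0 ∷ _ ∷ _) (_ , lt , _) with a (0 ∷ []) | e₀
... | .(var 0) | refl with lt
... | ()
IsωBody-sound {a} (_ , _ , e₁) (1 ∷ _ ∷ _) (_ , lt , _) with a (1 ∷ []) | e₁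
... | .(var 0) | refl with lt
... | ()

Isω-sound : ∀ {a} → Isω a → a ≈ ‵ω
Isω-sound (e , _) [] _ = e
Isω-sound (_ , b) (0 ∷ p) (_ , v) = IsωBody-sound b p v
Isω-sound {a} (e , _) (suc _ ∷ _) (lt , _) with root a | e
... | .lam | refl with lt
... | s<s ()

Is⊥-sound : ∀ {a} → Is⊥ a → a ≈ ‵⊥
Is⊥-sound (e , _) [] _ = e
Is⊥-sound (_ , ω₀ , _) (0 ∷ p) (_ , v) = Isω-sound ω₀ p v
Is⊥-sound (_ , _ , ω₁) (1 ∷ p) (_ , v) = Isω-sound ω₁ p v
Is⊥-sound {a} (e , _) (suc (suc _) ∷ _) (lt , _) with root a | e
... | .app | refl with lt
... | s<s (s<s ())

IsωBody-complete : ∀ {a} → a ≈ ‵ωbody → IsωBody a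
IsωBody-complete e =
  e [] tt , e (0 ∷ []) (<-arity (sym (e [] tt)) z<s , tt)
          , e (1 ∷ []) (<-arity (sym (e [] tt)) (s<s z<s) , tt)

Isω-complete : ∀ {a} → a ≈ ‵ω → Isω a
Isω-complete {a} e =
  e [] tt , IsωBody-complete (child-≈ {a} {‵ω} e (<-arity (sym (e [] tt)) z<s))

Is⊥-complete : ∀ {a} → a ≈ ‵⊥ → Is⊥ a
Is⊥-complete {a} e =
  e [] tt , Isω-complete (child-≈ {a} {‵⊥} e (<-arity (sym (e [] tt)) z<s))
          , Isω-complete (child-≈ {a} {‵⊥} e (<-arity (sym (e [] tt)) (s<s z<s)))

IsωBody-resp-≈ : ∀ {a b} → IsωBody a → a ≈ b → IsωBody b
IsωBody-resp-≈ h e = IsωBody-complete (≈-trans (≈-sym e) (IsωBody-sound h))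

Isω-resp-≈ : ∀ {a b} → Isω a → a ≈ b → Isω b
Isω-resp-≈ h e = Isω-complete (≈-trans (≈-sym e) (Isω-sound h))

Is⊥-resp-≈ : ∀ {a b} → Is⊥ a → a ≈ b → Is⊥ b
Is⊥-resp-≈ h e = Is⊥-complete (≈-trans (≈-sym e) (Is⊥-sound h))

NotVar : Label → Set
NotVar (var _) = ⊥
NotVar _       = ⊤

data RootView (t : Tm) : Set where
  var-root   : ∀ x → root t ≡ var x → RootView t
  other-root : ∀ l → NotVar l → root t ≡ l → RootView t

rootView : ∀ t → RootView t
rootView t with root t in e
... | var x  = var-root x e
... | con c  = other-root (con c) tt e
... | lam    = other-root lam tt e
... | app    = other-root app tt e
... | case s = other-root (case s) tt e

sub-var : ∀ σ t x p → root t ≡ var x → sub σ t p ≡ σ x p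
sub-var σ t x p e rewrite e = refl

sub-root : ∀ σ t l → root t ≡ l → NotVar l → sub σ t [] ≡ l
sub-root σ t (con c)  e _ rewrite e = refl
sub-root σ t lam      e _ rewrite e = refl
sub-root σ t app      e _ rewrite e = refl
sub-root σ t (case s) e _ rewrite e = refl

sub-child : ∀ σ t l i p → root t ≡ l → NotVar l →
            sub σ t (i ∷ p) ≡ sub (extsN (binds l i) σ) (child t i) p
sub-child σ t (con c)  i p e _ rewrite e = refl
sub-child σ t lam      i p e _ rewrite e = refl
sub-child σ t app      i p e _ rewrite e = refl
sub-child σ t (case s) i p e _ rewrite e = refl

renLab-cong : ∀ {ρ ρ′} → ρ ≗ ρ′ → ∀ l → renLab ρ l ≡ renLab ρ′ l
renLab-cong e (var x)  = cong var (e x)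
renLab-cong e (con _)  = refl
renLab-cong e lam      = refl
renLab-cong e app      = refl
renLab-cong e (case _) = refl

arity-renLab : ∀ ρ l → arity (renLab ρ l) ≡ arity l
arity-renLab ρ (var _)  = refl
arity-renLab ρ (con _)  = refl
arity-renLab ρ lam      = refl
arity-renLab ρ app      = refl
arity-renLab ρ (case _) = refl

liftR-cong : ∀ {ρ ρ′} → ρ ≗ ρ′ → liftR ρ ≗ liftR ρ′
liftR-cong e zero    = refl
liftR-cong e (suc x) = cong suc (e x)

liftRN-cong : ∀ {ρ ρ′} k → ρ ≗ ρ′ → liftRN k ρ ≗ liftRN k ρ′
liftRN-cong zero    e = e
liftRN-cong (suc k) e = liftR-cong (liftRN-cong k e)

ren-cong : ∀ {ρ ρ′ t t′} → ρ ≗ ρ′ → t ≐ t′ → ren ρ t ≐ ren ρ′ t′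
ren-cong {ρ} {ρ′} {t} {t′} eρ et [] =
  trans (cong (renLab ρ) (et [])) (renLab-cong eρ (root t′))
ren-cong {ρ} {ρ′} {t} {t′} eρ et (i ∷ p) =
  trans (cong (λ l → ren (liftRN (binds l i) ρ) (child t i) p) (et []))
        (ren-cong (liftRN-cong (binds (root t′) i) eρ) (child-≐ i et) p)

_≐ˢ_ : (ℕ → Tm) → (ℕ → Tm) → Set
σ ≐ˢ σ′ = ∀ x → σ x ≐ σ′ x

exts-cong : ∀ {σ σ′} → σ ≐ˢ σ′ → exts σ ≐ˢ exts σ′
exts-cong e zero    _ = refl
exts-cong e (suc x)   = ren-cong (λ _ → refl) (e x)

extsN-cong : ∀ {σ σ′} k → σ ≐ˢ σ′ → extsN k σ ≐ˢ extsN k σ′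
extsN-cong zero    e = e
extsN-cong (suc k) e = exts-cong (extsN-cong k e)

consSub-cong : ∀ {us us′} → Pointwise _≐_ us us′ → consSub us ≐ˢ consSub us′
consSub-cong []       x       _ = refl
consSub-cong (e ∷ _)  zero      = e
consSub-cong (_ ∷ es) (suc x)   = consSub-cong es x

sub-cong : ∀ {σ σ′ t t′} → σ ≐ˢ σ′ → t ≐ t′ → sub σ t ≐ sub σ′ t′
sub-cong {σ} {σ′} {t} {t′} eσ et p with rootView t
... | var-root x e =
  trans (sub-var σ t x p e) (trans (eσ x p) (sym (sub-var σ′ t′ x p (trans (sym (et [])) e))))
sub-cong {σ} {σ′} {t} {t′} eσ et [] | other-root l nv e =
  trans (sub-root σ t l e nv) (sym (sub-root σ′ t′ l (trans (sym (et [])) e) nv))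
sub-cong {σ} {σ′} {t} {t′} eσ et (i ∷ p) | other-root l nv e =
  trans (sub-child σ t l i p e nv)
    (trans (sub-cong (extsN-cong (binds l i) eσ) (child-≐ i et) p)
           (sym (sub-child σ′ t′ l i p (trans (sym (et [])) e) nv)))

Spine-≐ : ∀ {s s₁ c us} → s ≐ s₁ → Spine s c us →
          Σ (List Tm) (λ us₁ → Spine s₁ c us₁ × Pointwise _≐_ us us₁)
Spine-≐ es (head r) = [] , head (trans (sym (es [])) r) , []
Spine-≐ es (arg r sp) with Spine-≐ (child-≐ 0 es) sp
... | us₁ , sp₁ , pw = _ , arg (trans (sym (es [])) r) sp₁ , child-≐ 1 es ∷ pw

⟶-resp-≐ : ∀ {a a₁ b b₁} → a ≐ a₁ → b ≐ b₁ → a ⟶ b → a₁ ⟶ b₁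
⟶-resp-≐ ea eb (β r₁ r₂ e) =
  β (trans (sym (ea [])) r₁) (trans (sym (ea (0 ∷ []))) r₂)
    (≈-trans (≐⇒≈ (≐-sym eb))
      (≈-trans e (≐⇒≈ (sub-cong (consSub-cong (child-≐ 1 ea ∷ [])) (child-≐ 0 (child-≐ 0 ea))))))
⟶-resp-≐ ea eb (ι r u k lk sp len e) with Spine-≐ (child-≐ 0 ea) sp
... | us₁ , sp₁ , pw =
  ι (trans (sym (ea [])) r) u k lk sp₁ (trans (sym (Pointwise-length pw)) len)
    (≈-trans (≐⇒≈ (≐-sym eb))
      (≈-trans e (≐⇒≈ (sub-cong (consSub-cong pw) (child-≐ (suc (toℕ k)) ea)))))
⟶-resp-≐ {a} {a₁} {b} {b₁} ea eb (ctx i r lt st others) =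
  ctx i (trans (sym (ea [])) (trans r (eb []))) (<-arity (ea []) lt)
    (⟶-resp-≐ (child-≐ i ea) (child-≐ i eb) st) others₁
  where
  others₁ : ∀ j → j < arity (root a₁) → j ≢ i → child a₁ j ≈ child b₁ j
  others₁ j lt₁ ne =
    ≈-trans (≐⇒≈ (≐-sym (child-≐ j ea)))
      (≈-trans (others j (<-arity (sym (ea [])) lt₁) ne) (≐⇒≈ (child-≐ j eb)))

Star-resp-≐ˡ : ∀ {a a₁ b} → Star _⟶_ a b → a ≐ a₁ → Σ Tm (λ b₁ → Star _⟶_ a₁ b₁ × b ≐ b₁)
Star-resp-≐ˡ {a₁ = a₁} ε          e = a₁ , ε , e
Star-resp-≐ˡ           (st ◅ sts) e =
  _ , ⟶-resp-≐ e (λ _ → refl) st ◅ sts , λ _ → refl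

var-irreducible : ∀ {a b x} → root a ≡ var x → ¬ (a ⟶ b)
var-irreducible e (β r _ _) with trans (sym r) e
... | ()
var-irreducible e (ι r _ _ _ _ _ _) with trans (sym r) e
... | ()
var-irreducible e (ctx i _ lt _ _) with <-arity e lt
... | ()

Star-from-var : ∀ {a b x} → root a ≡ var x → Star _⟶_ a b → b ≡ a
Star-from-var e ε          = refl
Star-from-var e (st ◅ _) = ⊥-elim (var-irreducible e st)

⟶*-preserves : {Q : Tm → Set} → (∀ {a b} → Q a → a ⟶ b → Q b) →
               ∀ {a b} → Q a → Star _⟶_ a b → Q b
⟶*-preserves step q ε          = q
⟶*-preserves step q (st ◅ sts) = ⟶*-preserves step (step q st) sts

IsωBody-⟶ : ∀ {a b} → IsωBody a → a ⟶ b → IsωBody b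
IsωBody-⟶ (_ , e₀ , _) (β _ r _) with trans (sym r) e₀
... | ()
IsωBody-⟶ (e , _ , _) (ι r _ _ _ _ _ _) with trans (sym r) e
... | ()
IsωBody-⟶ {a} (e , e₀ , e₁) (ctx i _ lt st _) with <-arity e lt
... | z<s     = ⊥-elim (var-irreducible {child a 0} e₀ st)
... | s<s z<s = ⊥-elim (var-irreducible {child a 1} e₁ st)

Isω-⟶ : ∀ {a b} → Isω a → a ⟶ b → Isω b
Isω-⟶ (e , _) (β r _ _) with trans (sym r) e
... | ()
Isω-⟶ (e , _) (ι r _ _ _ _ _ _) with trans (sym r) e
... | ()
Isω-⟶ (e , b) (ctx i r lt st _) with <-arity e lt
... | z<s = trans (sym r) e , IsωBody-⟶ b st

-- ⊥ is its own β-contractum: (λx.xx)(λx.xx) → (λx.xx)(λx.xx).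
Is⊥-⟶ : ∀ {a b} → Is⊥ a → a ⟶ b → Is⊥ b
Is⊥-⟶ {a} (_ , (_ , e , e₀ , e₁) , ω₁) (β _ _ eb) =
  Is⊥-resp-≈ (sub-root σ body app e tt , Isω-resp-≈ ω₁ (arg≈ 0 e₀) , Isω-resp-≈ ω₁ (arg≈ 1 e₁)) (≈-sym eb)
  where
  σ = consSub (child a 1 ∷ [])
  body = child (child a 0) 0
  arg≈ : ∀ j → root (child body j) ≡ var 0 → child a 1 ≈ child (sub σ body) j
  arg≈ j ej = ≐⇒≈ λ p → sym (trans (sub-child σ body app j p e tt) (sub-var σ (child body j) 0 p ej))
Is⊥-⟶ (e , _) (ι r _ _ _ _ _ _) with trans (sym r) e
... | ()
Is⊥-⟶ (e , ω₀ , ω₁) (ctx i r lt st others) with <-arity e lt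
... | z<s     = trans (sym r) e , Isω-⟶ ω₀ st , Isω-resp-≈ ω₁ (others 1 (<-arity (sym e) (s<s z<s)) λ ())
... | s<s z<s = trans (sym r) e , Isω-resp-≈ ω₀ (others 0 (<-arity (sym e) z<s) λ ()) , Isω-⟶ ω₁ st

module ⊥-InfStable (S : Rel) (S-inf : S ⊆ InfStep S) where

  var0-∞ : ∀ {a v} → root a ≡ var 0 → S a v → root v ≡ var 0
  var0-∞ {a} {v} e h with S-inf a v h
  ... | s , (s₀ , sts , s₀≈s) , rs , _ with Star-from-var e sts
  ... | refl = trans (sym rs) (trans (sym (s₀≈s [] tt)) e)

  IsωBody-∞ : ∀ {a v} → IsωBody a → S a v → IsωBody v
  IsωBody-∞ {a} {v} b h with S-inf a v h
  ... | s , (s₀ , sts , s₀≈s) , rs , f =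
    trans (sym rs) (proj₁ bs) ,
    var0-∞ (proj₁ (proj₂ bs)) (f 0 (<-arity root≡ z<s)) ,
    var0-∞ (proj₂ (proj₂ bs)) (f 1 (<-arity root≡ (s<s z<s)))
    where
    bs : IsωBody s
    bs = IsωBody-resp-≈ (⟶*-preserves IsωBody-⟶ b sts) s₀≈s
    root≡ : app ≡ root v
    root≡ = trans (sym (proj₁ bs)) rs

  Isω-∞ : ∀ {a v} → Isω a → S a v → Isω v
  Isω-∞ {a} {v} o h with S-inf a v h
  ... | s , (s₀ , sts , s₀≈s) , rs , f =
    trans (sym rs) (proj₁ os) , IsωBody-∞ (proj₂ os) (f 0 (<-arity (trans (sym (proj₁ os)) rs) z<s))
    where
    os : Isω s
    os = Isω-resp-≈ (⟶*-preserves Isω-⟶ o sts) s₀≈s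

  Is⊥-∞ : ∀ {s v} → Is⊥ s → root s ≡ root v →
          (∀ i → i < arity (root v) → S (child s i) (child v i)) → Is⊥ v
  Is⊥-∞ (e , ω₀ , ω₁) rs f =
    trans (sym rs) e ,
    Isω-∞ ω₀ (f 0 (<-arity (trans (sym e) rs) z<s)) ,
    Isω-∞ ω₁ (f 1 (<-arity (trans (sym e) rs) (s<s z<s)))

-- ≻ quantifies over relations and lives in Set₁; this Set-valued reading checks
-- its defining condition at each finite position separately.

≻ᵖ-At : Tm → Tm → Pos → Set
≻ᵖ-At a b []      = Is⊥ b ⊎ (root a ≡ root b)
≻ᵖ-At a b (i ∷ p) = Is⊥ b ⊎ ((root a ≡ root b) × (i < arity (root a) → ≻ᵖ-At (child a i) (child b i) p))

_≻ᵖ_ : Tm → Tm → Set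
a ≻ᵖ b = ∀ p → ≻ᵖ-At a b p

≻ᵖ-Node : Tm → Tm → Set
≻ᵖ-Node a b = (root a ≡ root b) × (∀ i → i < arity (root a) → child a i ≻ᵖ child b i)

≻ᵖ-unfold : ∀ {a b} → a ≻ᵖ b → ¬ Is⊥ b → ≻ᵖ-Node a b
≻ᵖ-unfold {a} {b} h nb = same-root (h []) , λ i lt p → at-child lt (h (i ∷ p))
  where
  same-root : ≻ᵖ-At a b [] → root a ≡ root b
  same-root (inj₁ bt) = ⊥-elim (nb bt)
  same-root (inj₂ r)  = r
  at-child : ∀ {i p} → i < arity (root a) → ≻ᵖ-At a b (i ∷ p) → ≻ᵖ-At (child a i) (child b i) p
  at-child lt (inj₁ bt)     = ⊥-elim (nb bt)
  at-child lt (inj₂ (_ , f)) = f lt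

≻ᵖ-fold : ∀ {a b} → ≻ᵖ-Node a b → a ≻ᵖ b
≻ᵖ-fold (r , f) []      = inj₂ r
≻ᵖ-fold (r , f) (i ∷ p) = inj₂ (r , λ lt → f i lt p)

≻ᵖ-⊥ : ∀ {a b} → Is⊥ b → a ≻ᵖ b
≻ᵖ-⊥ bt []      = inj₁ bt
≻ᵖ-⊥ bt (_ ∷ _) = inj₁ bt

≻ᵖ-var : ∀ x → ‵var x ≻ᵖ ‵var x
≻ᵖ-var x []      = inj₂ refl
≻ᵖ-var x (_ ∷ _) = inj₂ (refl , λ ())

≻ᵖ-At-resp : ∀ {a a₁ b b₁} p → a ≐ a₁ → b ≈ b₁ → ≻ᵖ-At a b p → ≻ᵖ-At a₁ b₁ p
≻ᵖ-At-resp []      ea eb (inj₁ bt) = inj₁ (Is⊥-resp-≈ bt eb)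
≻ᵖ-At-resp []      ea eb (inj₂ r)  = inj₂ (trans (sym (ea [])) (trans r (eb [] tt)))
≻ᵖ-At-resp (i ∷ p) ea eb (inj₁ bt) = inj₁ (Is⊥-resp-≈ bt eb)
≻ᵖ-At-resp {b = b} {b₁} (i ∷ p) ea eb (inj₂ (r , f)) =
  inj₂ (trans (sym (ea [])) (trans r (eb [] tt)) , λ lt →
    let lt₀ = <-arity (sym (ea [])) lt in
    ≻ᵖ-At-resp p (child-≐ i ea) (child-≈ {b} {b₁} eb (<-arity r lt₀)) (f lt₀))

≻ᵖ-resp : ∀ {a a₁ b b₁} → a ≐ a₁ → b ≈ b₁ → a ≻ᵖ b → a₁ ≻ᵖ b₁
≻ᵖ-resp ea eb h p = ≻ᵖ-At-resp p ea eb (h p)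

≻⇒≻ᵖ : ∀ {R : Rel} → R ⊆ PreStep R → ∀ {a b} → R a b → a ≻ᵖ b
≻⇒≻ᵖ {R} R-pre {a} {b} h p with R-pre a b h | p
... | inj₁ b≈⊥      | []    = inj₁ (Is⊥-complete b≈⊥)
... | inj₁ b≈⊥      | _ ∷ _ = inj₁ (Is⊥-complete b≈⊥)
... | inj₂ (r , _) | []    = inj₂ r
... | inj₂ (r , f) | i ∷ q = inj₂ (r , λ lt → ≻⇒≻ᵖ R-pre (f i lt) q)

IsωBody-ren : ∀ {t} ρ → IsωBody t → IsωBody (ren (liftR ρ) t)
IsωBody-ren ρ (e , e₀ , e₁) rewrite e | e₀ | e₁ = refl , refl , refl

Isω-ren : ∀ {t} ρ → Isω t → Isω (ren ρ t)
Isω-ren {t} ρ (e , b) rewrite e = refl , IsωBody-ren {child t 0} ρ b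

Is⊥-ren : ∀ {t} ρ → Is⊥ t → Is⊥ (ren ρ t)
Is⊥-ren {t} ρ (e , ω₀ , ω₁) rewrite e = refl , Isω-ren {child t 0} ρ ω₀ , Isω-ren {child t 1} ρ ω₁

≻ᵖ-At-ren : ∀ p {ρ ρ′ b b′} → ρ ≗ ρ′ → b ≻ᵖ b′ → ≻ᵖ-At (ren ρ b) (ren ρ′ b′) p
≻ᵖ-At-ren p {ρ} {ρ′} {b} {b′} eρ h with is⊥? b′ | p
... | yes bt | []    = inj₁ (Is⊥-ren {b′} ρ′ bt)
... | yes bt | _ ∷ _ = inj₁ (Is⊥-ren {b′} ρ′ bt)
... | no nb  | q with ≻ᵖ-unfold h nb
... | r , f = at q
  where
  same-root : renLab ρ (root b) ≡ renLab ρ′ (root b′)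
  same-root = trans (cong (renLab ρ) r) (renLab-cong eρ (root b′))
  at : ∀ q → ≻ᵖ-At (ren ρ b) (ren ρ′ b′) q
  at []      = inj₂ same-root
  at (i ∷ q) = inj₂ (same-root , λ lt →
    ≻ᵖ-At-ren q (λ x → trans (cong (λ l → liftRN (binds l i) ρ x) r) (liftRN-cong (binds (root b′) i) eρ x))
      (f i (subst (i <_) (arity-renLab ρ (root b)) lt)))

≻ᵖ-ren : ∀ {ρ b b′} → b ≻ᵖ b′ → ren ρ b ≻ᵖ ren ρ b′
≻ᵖ-ren h p = ≻ᵖ-At-ren p (λ _ → refl) h

IsωBody-sub : ∀ {t} σ → IsωBody t → IsωBody (sub (exts σ) t)
IsωBody-sub {t} σ (e , e₀ , e₁) =
  sub-root (exts σ) t app e tt ,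
  trans (sub-child (exts σ) t app 0 [] e tt) (sub-var (exts σ) (child t 0) 0 [] e₀) ,
  trans (sub-child (exts σ) t app 1 [] e tt) (sub-var (exts σ) (child t 1) 0 [] e₁)

Isω-sub : ∀ {t} σ → Isω t → Isω (sub σ t)
Isω-sub {t} σ (e , b) =
  sub-root σ t lam e tt ,
  IsωBody-resp-≈ (IsωBody-sub {child t 0} σ b) (≐⇒≈ λ p → sym (sub-child σ t lam 0 p e tt))

Is⊥-sub : ∀ {t} σ → Is⊥ t → Is⊥ (sub σ t)
Is⊥-sub {t} σ (e , ω₀ , ω₁) =
  sub-root σ t app e tt ,
  Isω-resp-≈ (Isω-sub {child t 0} σ ω₀) (≐⇒≈ λ p → sym (sub-child σ t app 0 p e tt)) ,
  Isω-resp-≈ (Isω-sub {child t 1} σ ω₁) (≐⇒≈ λ p → sym (sub-child σ t app 1 p e tt))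

_≻ˢ_ : (ℕ → Tm) → (ℕ → Tm) → Set
σ ≻ˢ σ′ = ∀ x → σ x ≻ᵖ σ′ x

≻ˢ-exts : ∀ {σ σ′} → σ ≻ˢ σ′ → exts σ ≻ˢ exts σ′
≻ˢ-exts h zero    = ≻ᵖ-var 0
≻ˢ-exts h (suc x) = ≻ᵖ-ren (h x)

≻ˢ-extsN : ∀ {σ σ′} k → σ ≻ˢ σ′ → extsN k σ ≻ˢ extsN k σ′
≻ˢ-extsN zero    h = h
≻ˢ-extsN (suc k) h = ≻ˢ-exts (≻ˢ-extsN k h)

≻ˢ-consSub : ∀ {us us′} → Pointwise _≻ᵖ_ us us′ → consSub us ≻ˢ consSub us′
≻ˢ-consSub []       x       = ≻ᵖ-var x
≻ˢ-consSub (h ∷ _)  zero    = h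
≻ˢ-consSub (_ ∷ hs) (suc x) = ≻ˢ-consSub hs x

≻ᵖ-At-sub : ∀ p {σ σ′ b b′} → σ ≻ˢ σ′ → b ≻ᵖ b′ → ≻ᵖ-At (sub σ b) (sub σ′ b′) p
≻ᵖ-At-sub p {σ} {σ′} {b} {b′} hσ h with is⊥? b′ | p
... | yes bt | []    = inj₁ (Is⊥-sub {b′} σ′ bt)
... | yes bt | _ ∷ _ = inj₁ (Is⊥-sub {b′} σ′ bt)
... | no nb  | q with ≻ᵖ-unfold h nb | rootView b′
... | r , f | var-root x e =
  ≻ᵖ-At-resp q (λ s → sym (sub-var σ b x s (trans r e))) (≐⇒≈ λ s → sym (sub-var σ′ b′ x s e)) (hσ x q)
... | r , f | other-root l nv e = at q
  where
  same-root : sub σ b [] ≡ sub σ′ b′ []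
  same-root = trans (sub-root σ b l (trans r e) nv) (sym (sub-root σ′ b′ l e nv))
  at : ∀ q → ≻ᵖ-At (sub σ b) (sub σ′ b′) q
  at []      = inj₂ same-root
  at (i ∷ q) = inj₂ (same-root , λ lt →
    ≻ᵖ-At-resp q (λ s → sym (sub-child σ b l i s (trans r e) nv)) (≐⇒≈ λ s → sym (sub-child σ′ b′ l i s e nv))
      (≻ᵖ-At-sub q (≻ˢ-extsN (binds l i) hσ)
        (f i (<-arity (sym (trans r e)) (<-arity (sub-root σ b l (trans r e) nv) lt)))))

≻ᵖ-sub : ∀ {σ σ′ b b′} → σ ≻ˢ σ′ → b ≻ᵖ b′ → sub σ b ≻ᵖ sub σ′ b′
≻ᵖ-sub hσ h p = ≻ᵖ-At-sub p hσ h

Spine-root≢lam : ∀ {s c us} → Spine s c us → root s ≢ lam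
Spine-root≢lam (head r)  e with trans (sym r) e
... | ()
Spine-root≢lam (arg r _) e with trans (sym r) e
... | ()

Spine-¬⊥ : ∀ {s c us} → Spine s c us → ¬ Is⊥ s
Spine-¬⊥ (head r)   (e , _) with trans (sym r) e
... | ()
Spine-¬⊥ (arg _ sp) (_ , ω₀ , _) = Spine-root≢lam sp (proj₁ ω₀)

≻ᵖ-Spine : ∀ {s s′ c us′} → s ≻ᵖ s′ → Spine s′ c us′ →
           Σ (List Tm) (λ us → Spine s c us × Pointwise _≻ᵖ_ us us′)
≻ᵖ-Spine h sp′ with ≻ᵖ-unfold h (Spine-¬⊥ sp′) | sp′
... | r , _ | head r′ = [] , head (trans r r′) , []
... | r , f | arg r′ sp with ≻ᵖ-Spine (f 0 (<-arity (sym (trans r r′)) z<s)) sp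
... | us , sp₁ , pw = _ , arg (trans r r′) sp₁ , f 1 (<-arity (sym (trans r r′)) (s<s z<s)) ∷ pw

setChild : Tm → ℕ → Tm → Tm
setChild t i a []      = root t
setChild t i a (j ∷ p) with j ≟ i
... | yes _ = a p
... | no _  = t (j ∷ p)

setChild-≡ : ∀ t i a → child (setChild t i a) i ≐ a
setChild-≡ t i a p with i ≟ i
... | yes _ = refl
... | no ne = ⊥-elim (ne refl)

setChild-≢ : ∀ t i a j → j ≢ i → child (setChild t i a) j ≐ child t j
setChild-≢ t i a j ne p with j ≟ i
... | yes e = ⊥-elim (ne e)
... | no _  = refl

setChild-self : ∀ t i → t ≐ setChild t i (child t i)
setChild-self t i []      = refl
setChild-self t i (j ∷ p) with j ≟ i
... | yes refl = refl
... | no _     = refl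

⟶-setChild : ∀ {t i a a′} → i < arity (root t) → a ⟶ a′ → setChild t i a ⟶ setChild t i a′
⟶-setChild {t} {i} {a} {a′} lt st =
  ctx i refl lt (⟶-resp-≐ (≐-sym (setChild-≡ t i a)) (≐-sym (setChild-≡ t i a′)) st)
    λ j _ ne → ≐⇒≈ λ p → trans (setChild-≢ t i a j ne p) (sym (setChild-≢ t i a′ j ne p))

⟶*-child : ∀ {t i a} → i < arity (root t) → Star _⟶_ (child t i) a →
           Σ Tm (λ s → Star _⟶_ t s × s ≐ setChild t i a)
⟶*-child {t} {i} lt sts with Star-resp-≐ˡ (gmap (setChild t i) (⟶-setChild lt) sts) (≐-sym (setChild-self t i))
... | s , sts′ , e = s , sts′ , ≐-sym e

Simulated : Tm → Tm → Set
Simulated t s′ = Σ Tm (λ s → Star _⟶_ t s × s ≻ᵖ s′)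

simulate-β : ∀ {t t′ s′} → ≻ᵖ-Node t t′ → root t′ ≡ app → root (child t′ 0) ≡ lam →
             s′ ≈ sub (consSub (child t′ 1 ∷ [])) (child (child t′ 0) 0) → Simulated t s′
simulate-β {t′ = t′} (r , f) r₁ r₂ e with ≻ᵖ-unfold (f 0 (<-arity (sym (trans r r₁)) z<s)) (lam-¬⊥ {child t′ 0} r₂)
... | r′ , g =
  _ , β (trans r r₁) (trans r′ r₂) ≈-refl ◅ ε ,
  ≻ᵖ-resp (λ _ → refl) (≈-sym e)
    (≻ᵖ-sub (≻ˢ-consSub (f 1 (<-arity (sym (trans r r₁)) (s<s z<s)) ∷ []))
            (g 0 (<-arity (sym (trans r′ r₂)) z<s)))

simulate-ι : ∀ {t t′ s′ sig c m us′} → ≻ᵖ-Node t t′ → root t′ ≡ case sig →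
             Unique (map proj₁ sig) → (k : Fin (length sig)) → lookup sig k ≡ (c , m) →
             Spine (child t′ 0) c us′ → length us′ ≡ m →
             s′ ≈ sub (consSub us′) (child t′ (suc (toℕ k))) → Simulated t s′
simulate-ι (r , f) rc u k lk sp len e with ≻ᵖ-Spine (f 0 (<-arity (sym (trans r rc)) z<s)) sp
... | us , sp₁ , pw =
  _ , ι (trans r rc) u k lk sp₁ (trans (Pointwise-length pw) len) ≈-refl ◅ ε ,
  ≻ᵖ-resp (λ _ → refl) (≈-sym e)
    (≻ᵖ-sub (≻ˢ-consSub pw) (f (suc (toℕ k)) (<-arity (sym (trans r rc)) (s<s (toℕ<n k)))))

simulate-ctx : ∀ {t t′ s′} i → ≻ᵖ-Node t t′ → root t′ ≡ root s′ → i < arity (root t′) →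
               (∀ j → j < arity (root t′) → j ≢ i → child t′ j ≈ child s′ j) →
               Simulated (child t i) (child s′ i) → Simulated t s′
simulate-ctx {t} {t′} {s′} i (r , f) rr lt others (a , sts , ha) with ⟶*-child {t} {i} (<-arity (sym r) lt) sts
... | s , sts′ , e = s , sts′ , ≻ᵖ-resp (≐-sym e) ≈-refl (≻ᵖ-fold (trans r rr , children))
  where
  children : ∀ j → j < arity (root t) → child (setChild t i a) j ≻ᵖ child s′ j
  children j lt = by-index (j ≟ i)
    where
    by-index : Dec (j ≡ i) → child (setChild t i a) j ≻ᵖ child s′ j
    by-index (yes refl) = ≻ᵖ-resp (≐-sym (setChild-≡ t i a)) ≈-refl ha
    by-index (no ne)    = ≻ᵖ-resp (≐-sym (setChild-≢ t i a j ne)) (others j (<-arity r lt) ne) (f j lt)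

mutual

  ≻ᵖ-simulates-⟶ : ∀ {t t′ s′} → t ≻ᵖ t′ → t′ ⟶ s′ → Simulated t s′
  ≻ᵖ-simulates-⟶ {t} {t′} h st with is⊥? t′
  ... | yes bt = t , ε , ≻ᵖ-⊥ (Is⊥-⟶ bt st)
  ... | no nb  = ≻ᵖ-Node-simulates-⟶ (≻ᵖ-unfold h nb) st

  ≻ᵖ-Node-simulates-⟶ : ∀ {t t′ s′} → ≻ᵖ-Node t t′ → t′ ⟶ s′ → Simulated t s′
  ≻ᵖ-Node-simulates-⟶ {t} {t′} {s′} node (β r₁ r₂ e) =
    simulate-β {t} {t′} {s′} node r₁ r₂ e
  ≻ᵖ-Node-simulates-⟶ {t} {t′} {s′} node (ι rc u k lk sp len e) =
    simulate-ι {t} {t′} {s′} node rc u k lk sp len e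
  ≻ᵖ-Node-simulates-⟶ {t} {t′} {s′} (r , f) (ctx i rr lt st others) =
    simulate-ctx {t} {t′} {s′} i (r , f) rr lt others (≻ᵖ-simulates-⟶ (f i (<-arity (sym r) lt)) st)

≻ᵖ-simulates-⟶* : ∀ {t t′ s′} → t ≻ᵖ t′ → Star _⟶_ t′ s′ → Simulated t s′
≻ᵖ-simulates-⟶* {t} h ε = t , ε , h
≻ᵖ-simulates-⟶* h (st ◅ sts) with ≻ᵖ-simulates-⟶ h st
... | a , sts₁ , ha with ≻ᵖ-simulates-⟶* ha sts
... | b , sts₂ , hb = b , sts₁ ◅◅ sts₂ , hb

module Lifting (S : Rel) (S-inf : S ⊆ InfStep S) where

  open ⊥-InfStable S S-inf

  Between : Tm → Tm → Set
  Between t u′ = Σ Tm (λ t′ → t ≻ᵖ t′ × S t′ u′)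

  Layer : Tm → Tm → Set
  Layer t u′ = Is⊥ u′ ⊎ Σ Tm (λ s → Star _⟶_ t s × (root s ≡ root u′) ×
    (∀ i → i < arity (root u′) → Between (child s i) (child u′ i)))

  layer : ∀ t u′ → Between t u′ → Layer t u′
  layer t u′ (t′ , h , hs) with S-inf t′ u′ hs
  ... | s′ , (s₀ , sts , s₀≈s′) , rs , f with ≻ᵖ-simulates-⟶* h sts | is⊥? s′
  ... | _ , _ , _ | yes bt = inj₁ (Is⊥-∞ {s′} {u′} bt rs f)
  ... | s , sts₁ , hs₀ | no nb with ≻ᵖ-unfold (≻ᵖ-resp (λ _ → refl) s₀≈s′ hs₀) nb
  ... | r , g = inj₂ (s , sts₁ , trans r rs ,
                      λ i lt → child s′ i , g i (<-arity (sym (trans r rs)) lt) , f i lt)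

  lifted : ∀ t u′ → Layer t u′ → Tm
  lifted t u′ (inj₁ _) p                     = t p
  lifted t u′ (inj₂ (s , _ , _ , _)) []      = root s
  lifted t u′ (inj₂ (s , _ , _ , f)) (i ∷ p) with i <? arity (root u′)
  ... | yes lt = lifted (child s i) (child u′ i) (layer _ _ (f i lt)) p
  ... | no _   = var 0

  lifted-child : ∀ t u′ s sts rs f {i} → i < arity (root u′) →
                 Σ (Layer (child s i) (child u′ i))
                   (λ l → child (lifted t u′ (inj₂ (s , sts , rs , f))) i ≐ lifted (child s i) (child u′ i) l)
  lifted-child t u′ s sts rs f {i} lt with i <? arity (root u′)
  ... | yes lt′ = layer _ _ (f i lt′) , λ _ → refl
  ... | no ¬lt  = ⊥-elim (¬lt lt)

  Lifts : Tm → Tm → Tm → Set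
  Lifts t u′ u = Σ (Layer t u′) (λ l → u ≐ lifted t u′ l)

  -- The right summand accounts for the parts of u that are copied from t.
  R∞ : Rel
  R∞ a v = Σ Tm (λ u′ → Lifts a u′ v) ⊎ (a ≐ v)

  R∞-inf : R∞ ⊆ InfStep R∞
  R∞-inf a v (inj₂ e) = a , (a , ε , ≈-refl) , e [] , λ i _ → inj₂ (child-≐ i e)
  R∞-inf a v (inj₁ (u′ , inj₁ _ , e)) = a , (a , ε , ≈-refl) , sym (e []) , λ i _ → inj₂ (≐-sym (child-≐ i e))
  R∞-inf a v (inj₁ (u′ , inj₂ (s , sts , rs , f) , e)) =
    s , (s , sts , ≈-refl) , sym (e []) , λ i lt →
      let (l , el) = lifted-child a u′ s sts rs f (<-arity (trans (e []) rs) lt)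
      in inj₁ (child u′ i , l , λ p → trans (e (i ∷ p)) (el p))

  R≻ : Rel
  R≻ v u′ = Σ Tm (λ a → Lifts a u′ v)

  R≻-pre : R≻ ⊆ PreStep R≻
  R≻-pre v u′ (a , inj₁ bt , _) = inj₁ (Is⊥-sound bt)
  R≻-pre v u′ (a , inj₂ (s , sts , rs , f) , e) =
    inj₂ (trans (e []) rs , λ i lt →
      let (l , el) = lifted-child a u′ s sts rs f (<-arity (trans (e []) rs) lt)
      in child s i , l , λ p → trans (e (i ∷ p)) (el p))

lemma5p26 : (t t' u' : Tm) → t ≻ t' → t' ⟶∞ u' →
              Σ Tm (λ u → (t ⟶∞ u) × (u ≻ u'))
lemma5p26 t t' u' (R , R-pre , h) (S , S-inf , hs) =
  lifted t u' l₀ , (R∞ , R∞-inf , inj₁ (u' , l₀ , λ _ → refl)) , (R≻ , R≻-pre , t , l₀ , λ _ → refl)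
  where
  open Lifting S S-inf
  l₀ : Layer t u'
  l₀ = layer t u' (t' , ≻⇒≻ᵖ R-pre h , hs)
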